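{- Let $A,B$ be nonzero finite-dimensional $K$-subspaces of $L$. Then there exist a $K$-subspace $S$ of $\langle AB\rangle$ and a (possibly skew) subfield $H$ of $L$ with $K\subset H\subset L$ and $\dim_KH$ finite, such that $$\dim_KS\geq\dim_KA+\dim_KB-\dim_KH,$$ and either $HS=S$ or $SH=S$.
   Context: $K$ is a commutative field and $L$ is a (possibly noncommutative) division ring containing $K$ in its center. For $S\subset L$, $\langle S\rangle$ denotes the $K$-subspace of $L$ spanned by $S$. For subsets $S_1,S_2$ of $L$, $S_1S_2=\{s_1s_2\mid s_1\in S_1,s_2\in S_2\}$ (product set). -}

module Defs where

open import Algebra.Bundles using (Ring; CommutativeRing)
import Algebra.Definitions as AlgebraDefinitions
open import Algebra.Morphism.Structures using (IsRingMonomorphism)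
import Algebra.Properties.Monoid.Sum as MonoidSum
open import Data.Fin.Base using (Fin)
open import Data.Nat.Base using (ℕ)
open import Data.Product.Base using (∃; ∃-syntax; _×_)
open import Level using (Level; suc; _⊔_)
open import Relation.Nullary.Negation using (¬_)
open import Relation.Unary using (Pred; _∈_; _⊆_)

record IsDivisionRing {c ℓ} (R : Ring c ℓ) : Set (c ⊔ ℓ) where
  open Ring R
  open AlgebraDefinitions _≈_ using (Invertible)
  field
    1≉0        : ¬ (1# ≈ 0#)
    invertible : ∀ x → ¬ (x ≈ 0#) → Invertible 1# _*_ x

-- A commutative field K contained in the centre of a division ring L. The
-- inclusion is given by an injective ring homomorphism ι, so K acts on L by
-- c · x = ι c * x.
record CentralExtension (k kℓ l ℓ : Level) : Set (suc (k ⊔ kℓ ⊔ l ⊔ ℓ)) where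
  field
    fieldK : CommutativeRing k kℓ
    ringL  : Ring l ℓ

  module K = CommutativeRing fieldK
  module L = Ring ringL

  field
    isField              : IsDivisionRing K.ring
    isDivisionRing       : IsDivisionRing ringL
    ι                    : K.Carrier → L.Carrier
    ι-isRingMonomorphism : IsRingMonomorphism K.rawRing L.rawRing ι
    ι-central            : ∀ c x → ι c L.* x L.≈ x L.* ι c

module Linear {k kℓ l ℓ} (E : CentralExtension k kℓ l ℓ) where
  open CentralExtension E
  open L using (Carrier; _≈_; _+_; _*_; -_; 0#; 1#)
  open MonoidSum L.+-monoid using (sum)

  record IsSubspace {p} (V : Pred Carrier p) : Set (k ⊔ l ⊔ ℓ ⊔ p) where
    field
      resp-≈   : ∀ {x y} → x ≈ y → x ∈ V → y ∈ V
      0∈       : 0# ∈ V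
      +-closed : ∀ {x y} → x ∈ V → y ∈ V → x + y ∈ V
      ·-closed : ∀ c {x} → x ∈ V → ι c * x ∈ V

  Nonzero : ∀ {p} → Pred Carrier p → Set (l ⊔ ℓ ⊔ p)
  Nonzero V = ∃[ x ] (x ∈ V × ¬ (x ≈ 0#))

  combination : ∀ {n} → (Fin n → K.Carrier) → (Fin n → Carrier) → Carrier
  combination c v = sum (λ i → ι (c i) * v i)

  ⟨_⟩ : ∀ {p} → Pred Carrier p → Pred Carrier (k ⊔ l ⊔ ℓ ⊔ p)
  ⟨ X ⟩ x = ∃[ n ] ∃[ c ] ∃[ v ] ((∀ (i : Fin n) → v i ∈ X) × x ≈ combination c v)

  LinearlyIndependent : ∀ {n} → (Fin n → Carrier) → Set (k ⊔ kℓ ⊔ ℓ)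
  LinearlyIndependent v = ∀ c → combination c v ≈ 0# → ∀ i → c i K.≈ K.0#

  -- V is finite-dimensional over K and its dimension is n.
  record HasDim {p} (V : Pred Carrier p) (n : ℕ) : Set (k ⊔ kℓ ⊔ l ⊔ ℓ ⊔ p) where
    field
      basis       : Fin n → Carrier
      basis∈      : ∀ i → basis i ∈ V
      independent : LinearlyIndependent basis
      spanning    : ∀ {x} → x ∈ V → ∃[ c ] x ≈ combination c basis

  infixl 7 _∙_

  -- The product set, not its linear span.
  _∙_ : ∀ {p q} → Pred Carrier p → Pred Carrier q → Pred Carrier (l ⊔ ℓ ⊔ p ⊔ q)
  (X ∙ Y) z = ∃[ x ] ∃[ y ] (x ∈ X × y ∈ Y × z ≈ x * y)

  -- A possibly noncommutative subfield. Inverses in a ring are unique, so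
  -- inv-closed says that H contains the inverse in L of each nonzero element.
  record IsSubfield {p} (H : Pred Carrier p) : Set (l ⊔ ℓ ⊔ p) where
    field
      resp-≈     : ∀ {x y} → x ≈ y → x ∈ H → y ∈ H
      0∈         : 0# ∈ H
      1∈         : 1# ∈ H
      +-closed   : ∀ {x y} → x ∈ H → y ∈ H → x + y ∈ H
      -‿closed   : ∀ {x} → x ∈ H → - x ∈ H
      *-closed   : ∀ {x y} → x ∈ H → y ∈ H → x * y ∈ H
      inv-closed : ∀ {x y} → x ∈ H → x * y ≈ 1# → y ∈ H

  ContainsK : ∀ {p} → Pred Carrier p → Set (k ⊔ p)
  ContainsK H = ∀ c → ι c ∈ H

{-# OPTIONS --safe #-}
module Submission where

-- For a nonzero g in L, the pairs (A + Ag, B ∩ g⁻¹B) and (A ∩ Ag, B + g⁻¹B) still have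
-- their products in ⟨AB⟩, and their dimensions add up to 2(dim A + dim B). So, among
-- the pairs of nonzero subspaces with products in ⟨AB⟩, take one with dim A + dim B
-- maximal and then dim B minimal: every g with ag ∈ A and gb ∈ B for some nonzero a ∈ A,
-- b ∈ B now satisfies Ag ⊆ A and gB ⊆ B. Hence H = a⁻¹A ∩ Bb⁻¹ is a subfield that does
-- not depend on a and b. Suppose dim A ≤ dim B. If A = aH, then S = aB is stable under
-- aHa⁻¹ and dim H = dim A. Otherwise pick a₁ ∈ A outside aH: a nonzero element of
-- aB ∩ a₁B would put a⁻¹a₁ in H, so S = aB ⊕ a₁B has dimension 2 dim B, and K serves as
-- the subfield. The case dim B ≤ dim A is symmetric.

open import Defs
import Algebra.Properties.CommutativeSemigroup as CommutativeSemigroupProperties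
import Algebra.Properties.Group as GroupProperties
import Algebra.Properties.Ring as RingProperties
open import Algebra.Bundles using (CommutativeMonoid)
open import Algebra.Morphism.Structures using (IsRingMonomorphism)
open import Axiom.ExcludedMiddle using (ExcludedMiddle)
open import Data.Fin.Base using (zero; suc)
open import Data.Nat.Base using (ℕ; zero; suc; _+_; _≤_; _<_; z≤n; s≤s)
import Data.Nat.Properties as ℕ
open import Data.Product.Base
  using (Σ-syntax; ∃; ∃-syntax; ∃₂; _×_; _,_; proj₁; proj₂)
open import Data.Sum.Base using (_⊎_; inj₁; inj₂; [_,_]′)
open import Data.Vec.Functional as Vector using (Vector)
open import Function.Base using (id; _∘_)
open import Level using (_⊔_; Lift; lift; lower)
open import Relation.Binary.PropositionalEquality as ≡ using (_≡_)
import Relation.Binary.Reasoning.Setoid as SetoidReasoning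
open import Relation.Nullary using (Dec; yes; no; ¬_; contradiction)
open import Relation.Nullary.Decidable using (map′)
open import Relation.Unary using (Pred; _∈_; _∉_; _⊆_; _≐_)

-- By the two equations the sums `m₁ + n₁` and `m₂ + n₂` average to `m + n`, so if one does not
-- exceed it, the other does not fall below it.
complement-≥ : ∀ {m n m₁ m₂ n₁ n₂} → m₂ + m₁ ≡ m + m → n₁ + n₂ ≡ n + n →
  m₂ + n₂ ≤ m + n → m + n ≤ m₁ + n₁
complement-≥ {m} {n} {m₁} {m₂} {n₁} {n₂} eqm eqn le =
  ℕ.+-cancelʳ-≤ (m₂ + n₂) (m + n) (m₁ + n₁)
    (ℕ.≤-trans (ℕ.+-monoʳ-≤ (m + n) le) (ℕ.≤-reflexive (begin
      m + n + (m + n)     ≡⟨ interchange m n m n ⟩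
      m + m + (n + n)     ≡⟨ ≡.cong₂ _+_ (≡.trans (≡.sym eqm) (ℕ.+-comm m₂ m₁)) (≡.sym eqn) ⟩
      m₁ + m₂ + (n₁ + n₂) ≡⟨ interchange m₁ m₂ n₁ n₂ ⟩
      m₁ + n₁ + (m₂ + n₂) ∎)))
  where
  open ≡.≡-Reasoning
  open CommutativeSemigroupProperties ℕ.+-commutativeSemigroup using (interchange)

module LinearAlgebra
  {k kℓ l ℓ} (E : CentralExtension k kℓ l ℓ) (em : ExcludedMiddle (k ⊔ l ⊔ ℓ))
  where

  open CentralExtension E
  open Linear E
  open L using (Carrier; _≈_; _*_; -_; 0#; 1#) renaming (_+_ to _⊹_)
  open IsRingMonomorphism ι-isRingMonomorphism
    using (injective)
    renaming (⟦⟧-cong to ι-cong; 0#-homo to ι-0; 1#-homo to ι-1; -‿homo to ι-neg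
             ; +-homo to ι-+; *-homo to ι-*)
  open RingProperties ringL using (-‿distribˡ-*)
  open GroupProperties L.+-group
    using () renaming (//-rightDividesʳ to x+y-y)
  open CommutativeSemigroupProperties
    (CommutativeMonoid.commutativeSemigroup L.+-commutativeMonoid)
    using () renaming (interchange to +-interchange; xy∙z≈xz∙y to +-xy∙z≈xz∙y)
  open SetoidReasoning L.setoid

  -- The action of K on L.

  infixr 8 _·_
  _·_ : K.Carrier → Carrier → Carrier
  c · x = ι c * x

  ·-congʳ : ∀ c {x y} → x ≈ y → c · x ≈ c · y
  ·-congʳ c = L.*-congˡ

  ·-zero : ∀ {c} x → ι c ≈ 0# → c · x ≈ 0#
  ·-zero x ιc≈0 = L.trans (L.*-congʳ ιc≈0) (L.zeroˡ x)

  1·x≈x : ∀ x → K.1# · x ≈ x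
  1·x≈x x = L.trans (L.*-congʳ ι-1) (L.*-identityˡ x)

  -c·x≈-[c·x] : ∀ c x → (K.- c) · x ≈ - (c · x)
  -c·x≈-[c·x] c x = L.trans (L.*-congʳ (ι-neg c)) (L.sym (-‿distribˡ-* (ι c) x))

  *-·-comm : ∀ x c y → x * c · y ≈ c · (x * y)
  *-·-comm x c y = begin
    x * (ι c * y) ≈⟨ L.*-assoc x (ι c) y ⟨
    x * ι c * y   ≈⟨ L.*-congʳ (ι-central c x) ⟨
    ι c * x * y   ≈⟨ L.*-assoc (ι c) x y ⟩
    ι c * (x * y) ∎

  c⁻¹·c·x : ∀ {c d} → d K.* c K.≈ K.1# → ∀ x → d · c · x ≈ x
  c⁻¹·c·x {c} {d} dc≈1 x = begin
    ι d * (ι c * x) ≈⟨ L.*-assoc (ι d) (ι c) x ⟨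
    ι d * ι c * x   ≈⟨ L.*-congʳ (ι-* d c) ⟨
    ι (d K.* c) * x ≈⟨ L.*-congʳ (ι-cong dc≈1) ⟩
    K.1# · x        ≈⟨ 1·x≈x x ⟩
    x               ∎

  invertᴷ : ∀ {c} → ¬ ι c ≈ 0# → ∃[ d ] d K.* c K.≈ K.1#
  invertᴷ {c} ιc≉0
    with d , dc≈1 , _ ← IsDivisionRing.invertible isField c
                          (λ c≈0 → ιc≉0 (L.trans (ι-cong c≈0) ι-0))
    = d , dc≈1

  -- Subspaces, intersections and sums.

  module Closure {p} {V : Pred Carrier p} (V-isSubspace : IsSubspace V) where
    open IsSubspace V-isSubspace

    neg-closed : ∀ {x} → x ∈ V → - x ∈ V
    neg-closed {x} x∈V = resp-≈
      (L.trans (-c·x≈-[c·x] K.1# x) (L.-‿cong (1·x≈x x))) (·-closed (K.- K.1#) x∈V)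

    cancelʳ : ∀ {x y} → y ∈ V → x ⊹ y ∈ V → x ∈ V
    cancelʳ {x} {y} y∈V x+y∈V = resp-≈ (x+y-y y x) (+-closed x+y∈V (neg-closed y∈V))

    cancelˡ : ∀ {x y} → x ∈ V → x ⊹ y ∈ V → y ∈ V
    cancelˡ {x} {y} x∈V x+y∈V = cancelʳ x∈V (resp-≈ (L.+-comm x y) x+y∈V)

    ·-cancel : ∀ {c x} → ¬ ι c ≈ 0# → c · x ∈ V → x ∈ V
    ·-cancel {c} {x} ιc≉0 cx∈V with d , dc≈1 ← invertᴷ ιc≉0 =
      resp-≈ (c⁻¹·c·x dc≈1 x) (·-closed d cx∈V)

    combination-closed : ∀ {n} c {v : Vector Carrier n} → (∀ i → v i ∈ V) → combination c v ∈ V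
    combination-closed {zero}  c v∈V = 0∈
    combination-closed {suc n} c v∈V =
      +-closed (·-closed (c zero) (v∈V zero)) (combination-closed (c ∘ suc) (v∈V ∘ suc))

  -- The predicates share the level of `em`: membership is decidable, and intersections, sums and
  -- translates stay at the same level.
  record Subspace : Set (Level.suc (k ⊔ l ⊔ ℓ)) where
    constructor _,_
    field
      ⟦_⟧        : Pred Carrier (k ⊔ l ⊔ ℓ)
      isSubspace : IsSubspace ⟦_⟧
    open IsSubspace isSubspace public
    open Closure isSubspace public

  open Subspace using (⟦_⟧)

  _∈?_ : ∀ x (V : Subspace) → Dec (x ∈ ⟦ V ⟧)
  x ∈? V = em

  0ˢ : Subspace
  0ˢ = (λ x → Lift (k ⊔ l) (x ≈ 0#)) , record
    { resp-≈   = λ x≈y (lift x≈0) → lift (L.trans (L.sym x≈y) x≈0)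
    ; 0∈       = lift L.refl
    ; +-closed = λ (lift x≈0) (lift y≈0) → lift (L.trans (L.+-cong x≈0 y≈0) (L.+-identityˡ 0#))
    ; ·-closed = λ c (lift x≈0) → lift (L.trans (·-congʳ c x≈0) (L.zeroʳ (ι c)))
    }

  0ˢ⊆ : ∀ V → ⟦ 0ˢ ⟧ ⊆ ⟦ V ⟧
  0ˢ⊆ V (lift x≈0) = Subspace.resp-≈ V (L.sym x≈0) (Subspace.0∈ V)

  _≈0? : ∀ x → Dec (x ≈ 0#)
  x ≈0? = map′ lower lift (x ∈? 0ˢ)

  infixr 7 _∩_
  infixr 6 _+ˢ_

  _∩_ _+ˢ_ : Subspace → Subspace → Subspace
  V ∩ W = (λ x → x ∈ ⟦ V ⟧ × x ∈ ⟦ W ⟧) , record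
    { resp-≈   = λ x≈y (x∈V , x∈W) → V.resp-≈ x≈y x∈V , W.resp-≈ x≈y x∈W
    ; 0∈       = V.0∈ , W.0∈
    ; +-closed = λ (x∈V , x∈W) (y∈V , y∈W) → V.+-closed x∈V y∈V , W.+-closed x∈W y∈W
    ; ·-closed = λ c (x∈V , x∈W) → V.·-closed c x∈V , W.·-closed c x∈W
    }
    where
    module V = Subspace V
    module W = Subspace W
  V +ˢ W = (λ x → ∃₂ λ v w → v ∈ ⟦ V ⟧ × w ∈ ⟦ W ⟧ × x ≈ v ⊹ w) , record
    { resp-≈   = λ x≈y (v , w , v∈V , w∈W , eq) →
        v , w , v∈V , w∈W , L.trans (L.sym x≈y) eq
    ; 0∈       = 0# , 0# , V.0∈ , W.0∈ , L.sym (L.+-identityˡ 0#)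
    ; +-closed = λ (v , w , v∈V , w∈W , eq) (v′ , w′ , v′∈V , w′∈W , eq′) →
        v ⊹ v′ , w ⊹ w′ , V.+-closed v∈V v′∈V , W.+-closed w∈W w′∈W ,
        L.trans (L.+-cong eq eq′) (+-interchange v w v′ w′)
    ; ·-closed = λ c (v , w , v∈V , w∈W , eq) →
        c · v , c · w , V.·-closed c v∈V , W.·-closed c w∈W ,
        L.trans (·-congʳ c eq) (L.distribˡ (ι c) v w)
    }
    where
    module V = Subspace V
    module W = Subspace W

  +ˢ-inˡ : ∀ V W → ⟦ V ⟧ ⊆ ⟦ V +ˢ W ⟧
  +ˢ-inˡ V W {x} x∈V = x , 0# , x∈V , Subspace.0∈ W , L.sym (L.+-identityʳ x)

  +ˢ-inʳ : ∀ V W → ⟦ W ⟧ ⊆ ⟦ V +ˢ W ⟧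
  +ˢ-inʳ V W {x} x∈W = 0# , x , Subspace.0∈ V , x∈W , L.sym (L.+-identityˡ x)

  +ˢ-least : ∀ V W X → ⟦ V ⟧ ⊆ ⟦ X ⟧ → ⟦ W ⟧ ⊆ ⟦ X ⟧ → ⟦ V +ˢ W ⟧ ⊆ ⟦ X ⟧
  +ˢ-least V W X V⊆X W⊆X (v , w , v∈V , w∈W , eq) =
    X.resp-≈ (L.sym eq) (X.+-closed (V⊆X v∈V) (W⊆X w∈W))
    where
    module X = Subspace X

  -- Chains of one-dimensional steps and dimension.

  -- W ⋖ W′ says that W has codimension one in W′. The sign in `cover` makes c
  -- the negative of the coordinate of y along `new`.
  infix 4 _⋖_
  record _⋖_ (W W′ : Subspace) : Set (k ⊔ l ⊔ ℓ) where
    field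
      inclusion : ⟦ W ⟧ ⊆ ⟦ W′ ⟧
      new       : Carrier
      new∈      : new ∈ ⟦ W′ ⟧
      new∉      : new ∉ ⟦ W ⟧
      cover     : ∀ {y} → y ∈ ⟦ W′ ⟧ → ∃[ c ] y ⊹ c · new ∈ ⟦ W ⟧

  -- A composition series, whose length is the dimension of W modulo V. `done` asks for mutual
  -- inclusion because different predicates can describe one subspace.
  data Chain (V : Subspace) : ℕ → Subspace → Set (Level.suc (k ⊔ l ⊔ ℓ)) where
    done : ∀ {W} → ⟦ V ⟧ ≐ ⟦ W ⟧ → Chain V 0 W
    _▸_  : ∀ {n W W′} → Chain V n W → W ⋖ W′ → Chain V (suc n) W′

  Dim : Subspace → ℕ → Set (Level.suc (k ⊔ l ⊔ ℓ))
  Dim V n = Chain 0ˢ n V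

  chain-⊆ : ∀ {V W n} → Chain V n W → ⟦ V ⟧ ⊆ ⟦ W ⟧
  chain-⊆ (done V≐W) = proj₁ V≐W
  chain-⊆ (ch ▸ W⋖W′) = _⋖_.inclusion W⋖W′ ∘ chain-⊆ ch

  ≐-trans : ∀ {U V W} → ⟦ U ⟧ ≐ ⟦ V ⟧ → ⟦ V ⟧ ≐ ⟦ W ⟧ → ⟦ U ⟧ ≐ ⟦ W ⟧
  ≐-trans (f , f′) (g , g′) = (λ x∈ → g (f x∈)) , (λ x∈ → f′ (g′ x∈))

  ⋖-respʳ : ∀ {V W W′} → ⟦ W ⟧ ≐ ⟦ W′ ⟧ → V ⋖ W → V ⋖ W′
  ⋖-respʳ (W⊆W′ , W′⊆W) V⋖W = record
    { inclusion = λ x∈V → W⊆W′ (inclusion x∈V)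
    ; new = new ; new∈ = W⊆W′ new∈ ; new∉ = new∉
    ; cover = λ y∈W′ → cover (W′⊆W y∈W′)
    }
    where open _⋖_ V⋖W

  chain-respʳ : ∀ {V W W′ n} → ⟦ W ⟧ ≐ ⟦ W′ ⟧ → Chain V n W → Chain V n W′
  chain-respʳ {V} {W} {W′} W≐W′ (done V≐W) = done (≐-trans {V} {W} {W′} V≐W W≐W′)
  chain-respʳ W≐W′ (ch ▸ cov) = ch ▸ ⋖-respʳ W≐W′ cov

  chain-respˡ : ∀ {V V′ W n} → ⟦ V′ ⟧ ≐ ⟦ V ⟧ → Chain V n W → Chain V′ n W
  chain-respˡ {V} {V′} {W} V′≐V (done V≐W) = done (≐-trans {V′} {V} {W} V′≐V V≐W)
  chain-respˡ V′≐V (ch ▸ cov) = chain-respˡ V′≐V ch ▸ cov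

  chain-trans : ∀ {U V W m n} → Chain U m V → Chain V n W → Chain U (n + m) W
  chain-trans ch (done V≐W)  = chain-respʳ V≐W ch
  chain-trans ch (ch′ ▸ cov) = chain-trans ch ch′ ▸ cov

  -- Modular law: a one-dimensional step survives in exactly one of W ∩ U and W + U.
  ⋖-split : ∀ {W W′} → W ⋖ W′ → ∀ U →
    (W ∩ U ⋖ W′ ∩ U × ⟦ W +ˢ U ⟧ ≐ ⟦ W′ +ˢ U ⟧) ⊎
    (⟦ W ∩ U ⟧ ≐ ⟦ W′ ∩ U ⟧ × W +ˢ U ⋖ W′ +ˢ U)
  ⋖-split {W} {W′} W⋖W′ U with _⋖_.new W⋖W′ ∈? (W +ˢ U)
  ... | yes x∈W+U@(w , u , w∈W , u∈U , x≈w+u) = inj₁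
    ( record
      { inclusion = λ (y∈W , y∈U) → inclusion y∈W , y∈U
      -- `u` differs from the old new vector by `w ∈ W`, so coordinates modulo `W` are unchanged,
      -- and it lies in `U`.
      ; new  = u
      ; new∈ = W′.cancelˡ (inclusion w∈W) (W′.resp-≈ x≈w+u new∈) , u∈U
      ; new∉ = λ (u∈W , _) → new∉ (W.resp-≈ (L.sym x≈w+u) (W.+-closed w∈W u∈W))
      ; cover = λ (y∈W′ , y∈U) → let c , y+cx∈W = cover y∈W′ in
          c , W.cancelʳ (W.·-closed c w∈W) (W.resp-≈ (rearrange _ c) y+cx∈W)
            , U.+-closed y∈U (U.·-closed c u∈U)
      }
    , (λ (v , u′ , v∈W , u′∈U , eq) → v , u′ , inclusion v∈W , u′∈U , eq)
    , +ˢ-least W′ U (W +ˢ U) W′⊆W+U (+ˢ-inʳ W U)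
    )
    where
    open _⋖_ W⋖W′
    module W  = Subspace W
    module W′ = Subspace W′
    module U  = Subspace U
    module W+U = Subspace (W +ˢ U)

    rearrange : ∀ y c → y ⊹ c · new ≈ y ⊹ c · u ⊹ c · w
    rearrange y c = begin
      y ⊹ c · new           ≈⟨ L.+-congˡ (·-congʳ c (L.trans x≈w+u (L.+-comm w u))) ⟩
      y ⊹ c · (u ⊹ w)       ≈⟨ L.+-congˡ (L.distribˡ (ι c) u w) ⟩
      y ⊹ (c · u ⊹ c · w)   ≈⟨ L.+-assoc y (c · u) (c · w) ⟨
      y ⊹ c · u ⊹ c · w     ∎

    W′⊆W+U : ⟦ W′ ⟧ ⊆ ⟦ W +ˢ U ⟧
    W′⊆W+U y∈W′ with c , y+cx∈W ← cover y∈W′ =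
      W+U.cancelʳ (W+U.·-closed c x∈W+U) (+ˢ-inˡ W U y+cx∈W)
  ... | no x∉W+U = inj₂
    ( ((λ (y∈W , y∈U) → inclusion y∈W , y∈U) , λ (y∈W′ , y∈U) → W′∩U⊆W y∈W′ y∈U , y∈U)
    , record
      { inclusion = λ (v , u , v∈W , u∈U , eq) → v , u , inclusion v∈W , u∈U , eq
      ; new  = new
      ; new∈ = +ˢ-inˡ W′ U new∈
      ; new∉ = x∉W+U
      ; cover = λ (v , u , v∈W′ , u∈U , y≈v+u) → let c , v+cx∈W = cover v∈W′ in
          c , v ⊹ c · new , u , v+cx∈W , u∈U ,
          L.trans (L.+-congʳ y≈v+u) (+-xy∙z≈xz∙y v u (c · new))
      }
    )
    where
    open _⋖_ W⋖W′
    module W  = Subspace W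
    module W+U = Subspace (W +ˢ U)

    W′∩U⊆W : ∀ {y} → y ∈ ⟦ W′ ⟧ → y ∈ ⟦ U ⟧ → y ∈ ⟦ W ⟧
    W′∩U⊆W {y} y∈W′ y∈U with c , y+cx∈W ← cover y∈W′ with ι c ≈0?
    ... | yes ιc≈0 =
      W.resp-≈ (L.trans (L.+-congˡ (·-zero new ιc≈0)) (L.+-identityʳ y)) y+cx∈W
    -- Subtracting `y ∈ U` from an element of `W` would put `c · new`, hence `new`, in `W +ˢ U`.
    ... | no ιc≉0 = contradiction
      (W+U.·-cancel ιc≉0 (W+U.cancelˡ (+ˢ-inʳ W U y∈U) (+ˢ-inˡ W U y+cx∈W))) x∉W+U

  -- Each step lengthens exactly one of the two chains, by `⋖-split`.
  chain-split : ∀ {V W n} → Chain V n W → ∀ U → ∃₂ λ p r →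
    Chain (V ∩ U) p (W ∩ U) × Chain (V +ˢ U) r (W +ˢ U) × p + r ≡ n
  chain-split (done (V⊆W , W⊆V)) U = 0 , 0 ,
    done ((λ (x∈V , x∈U) → V⊆W x∈V , x∈U) , (λ (x∈W , x∈U) → W⊆V x∈W , x∈U)) ,
    done ( (λ (v , u , v∈ , u∈ , eq) → v , u , V⊆W v∈ , u∈ , eq)
         , (λ (v , u , v∈ , u∈ , eq) → v , u , W⊆V v∈ , u∈ , eq)) ,
    ≡.refl
  chain-split (ch ▸ cov) U with chain-split ch U | ⋖-split cov U
  ... | p , r , ch∩ , ch+ , ≡.refl | inj₁ (cov∩ , eq) =
    suc p , r , ch∩ ▸ cov∩ , chain-respʳ eq ch+ , ≡.refl
  ... | p , r , ch∩ , ch+ , ≡.refl | inj₂ (eq , cov+) =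
    p , suc r , chain-respʳ eq ch∩ , ch+ ▸ cov+ , ℕ.+-suc p r

  -- Splitting a chain for `V` along `W` gives one from 0 to `V ∩ W` and one that continues a chain
  -- for `W` up to `V +ˢ W`.
  dim-∩-+ : ∀ {V W m n} → Dim V m → Dim W n →
    ∃₂ λ p q → Dim (V ∩ W) p × Dim (V +ˢ W) q × p + q ≡ m + n
  dim-∩-+ {V} {W} {m} {n} V-dim W-dim
    with p , r , ch∩ , ch+ , p+r≡m ← chain-split V-dim W =
      p , r + n
    , chain-respˡ ((λ x∈0 → x∈0 , 0ˢ⊆ W x∈0) , proj₁) ch∩
    , chain-trans W-dim (chain-respˡ (+ˢ-inʳ 0ˢ W , +ˢ-least 0ˢ W W (0ˢ⊆ W) id) ch+)
    , ≡.trans (≡.sym (ℕ.+-assoc p r n)) (≡.cong (_+ n) p+r≡m)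

  -- In a longer chain, the new vector of the step before last has a nonzero coordinate along the
  -- vector that generates W over V. That vector then lies in the last proper term, which leaves
  -- nothing new for the final step.
  ⋖-chain-length : ∀ {V W n} → V ⋖ W → Chain V n W → n ≡ 1
  ⋖-chain-length V⋖W (done (_ , W⊆V)) = contradiction (W⊆V new∈) new∉
    where open _⋖_ V⋖W
  ⋖-chain-length V⋖W (done _ ▸ _) = ≡.refl
  ⋖-chain-length {V} V⋖W (_▸_ {W = W₁} (_▸_ {W = W₀} ch W₀⋖W₁) W₁⋖W)
    with c , x₁+cx∈V ← _⋖_.cover V⋖W (_⋖_.inclusion W₁⋖W (_⋖_.new∈ W₀⋖W₁)) =
      contradiction x₂∈W₁ (_⋖_.new∉ W₁⋖W)
    where
    module W₁ = Subspace W₁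
    x x₁ x₂ : Carrier
    x  = _⋖_.new V⋖W
    x₁ = _⋖_.new W₀⋖W₁
    x₂ = _⋖_.new W₁⋖W
    V⊆W₁ : ⟦ V ⟧ ⊆ ⟦ W₁ ⟧
    V⊆W₁ y∈V = _⋖_.inclusion W₀⋖W₁ (chain-⊆ ch y∈V)

    ιc≉0 : ¬ ι c ≈ 0#
    ιc≉0 ιc≈0 = _⋖_.new∉ W₀⋖W₁ (chain-⊆ ch (Subspace.resp-≈ V
      (L.trans (L.+-congˡ (·-zero x ιc≈0)) (L.+-identityʳ x₁)) x₁+cx∈V))

    x∈W₁ : x ∈ ⟦ W₁ ⟧
    x∈W₁ = W₁.·-cancel ιc≉0 (W₁.cancelˡ (_⋖_.new∈ W₀⋖W₁) (V⊆W₁ x₁+cx∈V))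

    x₂∈W₁ : x₂ ∈ ⟦ W₁ ⟧
    x₂∈W₁ with d , x₂+dx∈V ← _⋖_.cover V⋖W (_⋖_.new∈ W₁⋖W) =
      W₁.cancelʳ (W₁.·-closed d x∈W₁) (V⊆W₁ x₂+dx∈V)

  -- Split along `U`: as V ⊆ U ⊆ W, the intersections run from V to U and the sums from U to W.
  split-⊆ : ∀ {V U W n} → ⟦ V ⟧ ⊆ ⟦ U ⟧ → ⟦ U ⟧ ⊆ ⟦ W ⟧ → Chain V n W →
    ∃₂ λ p r → Chain V p U × Chain U r W × p + r ≡ n
  split-⊆ {V} {U} {W} V⊆U U⊆W ch with p , r , ch∩ , ch+ , eq ← chain-split ch U =
      p , r
    , chain-respˡ ((λ x∈V → x∈V , V⊆U x∈V) , proj₁)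
        (chain-respʳ (proj₂ , λ x∈U → U⊆W x∈U , x∈U) ch∩)
    , chain-respˡ (+ˢ-inʳ V U , +ˢ-least V U U V⊆U id)
        (chain-respʳ (+ˢ-least W U W id U⊆W , +ˢ-inˡ W U) ch+)
    , eq

  -- As in the Jordan-Hölder theorem: reroute the second chain through the last proper term of the
  -- first, where exactly one step remains, and recurse.
  chain-length-unique : ∀ {V W m n} → Chain V m W → Chain V n W → m ≡ n
  chain-length-unique (done _) (done _) = ≡.refl
  chain-length-unique (done (_ , W⊆V)) (ch ▸ cov) =
    contradiction (chain-⊆ ch (W⊆V new∈)) new∉
    where open _⋖_ cov
  chain-length-unique (_▸_ {W = W} ch cov) ch′
    with p , r , chp , chr , ≡.refl ← split-⊆ {U = W} (chain-⊆ ch) (_⋖_.inclusion cov) ch′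
    rewrite ⋖-chain-length cov chr | chain-length-unique ch chp = ℕ.+-comm 1 p

  dim-mono : ∀ {V W m n} → Dim V m → Dim W n → ⟦ V ⟧ ⊆ ⟦ W ⟧ → m ≤ n
  dim-mono {V} V-dim W-dim V⊆W
    with p , r , chp , chr , ≡.refl ← split-⊆ {U = V} (0ˢ⊆ V) V⊆W W-dim
    rewrite chain-length-unique V-dim chp = ℕ.m≤m+n p r

  dim-≥⇒⊇ : ∀ {V W m n} → Dim V m → Dim W n → ⟦ V ⟧ ⊆ ⟦ W ⟧ → n ≤ m → ⟦ W ⟧ ⊆ ⟦ V ⟧
  dim-≥⇒⊇ {V} {W} V-dim W-dim V⊆W n≤m
    with split-⊆ {U = V} (0ˢ⊆ V) V⊆W W-dim
  ... | p , zero , chp , done (_ , W⊆V) , _ = W⊆V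
  ... | p , suc r , chp , chr , ≡.refl rewrite chain-length-unique V-dim chp =
    contradiction n≤m (ℕ.m+1+n≰m p)

  dim-sub : ∀ {V W n} → ⟦ V ⟧ ⊆ ⟦ W ⟧ → Dim W n → ∃ (Dim V)
  dim-sub {V} V⊆W W-dim with p , _ , chp , _ ← split-⊆ {U = V} (0ˢ⊆ V) V⊆W W-dim = p , chp

  -- Chains versus bases; spans.

  dim⇒HasDim : ∀ {V n} → Dim V n → HasDim ⟦ V ⟧ n
  dim⇒HasDim (done (_ , V⊆0)) = record
    { basis = λ () ; basis∈ = λ () ; independent = λ _ _ ()
    ; spanning = λ x∈V → (λ ()) , lower (V⊆0 x∈V)
    }
  dim⇒HasDim (_▸_ {W = W} {W′ = W′} ch W⋖W′) = record
    { basis       = new Vector.∷ basis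
    ; basis∈      = λ { zero → new∈ ; (suc i) → inclusion (basis∈ i) }
    ; independent = independent′
    ; spanning    = λ x∈W′ → let c , x+cb∈W = cover x∈W′ ; d , eq = spanning x+cb∈W in
        (K.- c) Vector.∷ d , split-off eq
    }
    where
    open _⋖_ W⋖W′
    open HasDim (dim⇒HasDim ch)
    module W = Subspace W

    independent′ : LinearlyIndependent (new Vector.∷ basis)
    independent′ c eq with ι (c zero) ≈0?
    ... | no ιc₀≉0 = contradiction
      (W.·-cancel ιc₀≉0 (W.cancelʳ (W.combination-closed (c ∘ suc) basis∈)
        (W.resp-≈ (L.sym eq) W.0∈))) new∉
    ... | yes ιc₀≈0 = λ
      { zero    → injective (L.trans ιc₀≈0 (L.sym ι-0))
      ; (suc i) → independent (c ∘ suc) tail≈0 i }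
      where
      tail≈0 : combination (c ∘ suc) basis ≈ 0#
      tail≈0 = L.trans (L.sym (L.trans (L.+-congʳ (·-zero new ιc₀≈0)) (L.+-identityˡ _))) eq

    split-off : ∀ {x y c} → x ⊹ c · new ≈ y → x ≈ (K.- c) · new ⊹ y
    split-off {x} {y} {c} eq = begin
      x                             ≈⟨ x+y-y (c · new) x ⟨
      x ⊹ c · new ⊹ - (c · new)     ≈⟨ L.+-cong eq (L.sym (-c·x≈-[c·x] c new)) ⟩
      y ⊹ (K.- c) · new             ≈⟨ L.+-comm _ _ ⟩
      (K.- c) · new ⊹ y             ∎

  line : Carrier → Subspace
  line x = (λ y → Lift l (∃[ c ] y ≈ c · x)) , record
    { resp-≈   = λ y≈z (lift (c , y≈cx)) → lift (c , L.trans (L.sym y≈z) y≈cx)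
    ; 0∈       = lift (K.0# , L.sym (·-zero x ι-0))
    ; +-closed = λ (lift (c , y≈cx)) (lift (d , z≈dx)) → lift (c K.+ d ,
        L.trans (L.+-cong y≈cx z≈dx)
          (L.sym (L.trans (L.*-congʳ (ι-+ c d)) (L.distribʳ x (ι c) (ι d)))))
    ; ·-closed = λ d (lift (c , y≈cx)) → lift (d K.* c ,
        L.trans (·-congʳ d y≈cx)
          (L.sym (L.trans (L.*-congʳ (ι-* d c)) (L.*-assoc (ι d) (ι c) x))))
    }

  line-self : ∀ x → x ∈ ⟦ line x ⟧
  line-self x = lift (K.1# , L.sym (1·x≈x x))

  ⋖-adjoin : ∀ V {x} → x ∉ ⟦ V ⟧ → V ⋖ V +ˢ line x
  ⋖-adjoin V {x} x∉V = record
    { inclusion = +ˢ-inˡ V (line x)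
    ; new  = x
    ; new∈ = +ˢ-inʳ V (line x) (line-self x)
    ; new∉ = x∉V
    ; cover = λ { (v , y , v∈V , lift (c , y≈cx) , eq) → K.- c , Subspace.resp-≈ V
        (L.sym (L.trans (L.+-cong (L.trans eq (L.+-congˡ y≈cx)) (-c·x≈-[c·x] c x))
                        (x+y-y (c · x) v))) v∈V }
    }

  span : ∀ {n} → Vector Carrier n → Subspace
  span {zero}  v = 0ˢ
  span {suc n} v = span (v ∘ suc) +ˢ line (v zero)

  combination∈span : ∀ {n} c (v : Vector Carrier n) → combination c v ∈ ⟦ span v ⟧
  combination∈span {zero}  c v = Subspace.0∈ 0ˢ
  combination∈span {suc n} c v =
    combination (c ∘ suc) (v ∘ suc) , c zero · v zero ,
    combination∈span (c ∘ suc) (v ∘ suc) , lift (c zero , L.refl) , L.+-comm _ _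

  span⇒combination : ∀ {n} (v : Vector Carrier n) {x} →
    x ∈ ⟦ span v ⟧ → ∃[ c ] x ≈ combination c v
  span⇒combination {zero}  v (lift x≈0) = (λ ()) , x≈0
  span⇒combination {suc n} v (y , z , y∈ , lift (c₀ , z≈c₀v₀) , eq)
    with c , y≈cv ← span⇒combination (v ∘ suc) y∈ =
      c₀ Vector.∷ c , L.trans eq (L.trans (L.+-cong y≈cv z≈c₀v₀) (L.+-comm _ _))

  independent⇒dim-span : ∀ {n} (v : Vector Carrier n) → LinearlyIndependent v → Dim (span v) n
  independent⇒dim-span {zero}  v indep = done (id , id)
  independent⇒dim-span {suc n} v indep =
    independent⇒dim-span (v ∘ suc) tail-independent ▸ ⋖-adjoin (span (v ∘ suc)) head∉
    where
    tail-independent : LinearlyIndependent (v ∘ suc)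
    tail-independent c eq = indep (K.0# Vector.∷ c)
      (L.trans (L.+-cong (·-zero (v zero) ι-0) eq) (L.+-identityˡ 0#)) ∘ suc

    head∉ : v zero ∉ ⟦ span (v ∘ suc) ⟧
    -- Membership would give a relation with coefficient -1 at the head, and independence would make
    -- -1 zero.
    head∉ v₀∈ with c , v₀≈cv ← span⇒combination (v ∘ suc) v₀∈ =
      IsDivisionRing.1≉0 isField (K-⁻¹-injective
        (K.trans (indep ((K.- K.1#) Vector.∷ c) eq zero) (K.sym -0≈0)))
      where
      open GroupProperties K.+-group
        using () renaming (⁻¹-injective to K-⁻¹-injective; ε⁻¹≈ε to -0≈0)
      eq : (K.- K.1#) · v zero ⊹ combination c (v ∘ suc) ≈ 0#
      eq = L.trans (L.+-cong (L.trans (-c·x≈-[c·x] K.1# (v zero)) (L.-‿cong (1·x≈x (v zero))))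
                             (L.sym v₀≈cv))
                   (L.-‿inverseˡ (v zero))

  -- Multiplications as linear automorphisms; translates.

  -- `from` is a mere section of `to`; with the trivial kernel it is forced to be linear.
  record Automorphism : Set (k ⊔ l ⊔ ℓ) where
    field
      to from : Carrier → Carrier
      to-cong : ∀ {x y} → x ≈ y → to x ≈ to y
      to-0    : to 0# ≈ 0#
      to-+    : ∀ x y → to (x ⊹ y) ≈ to x ⊹ to y
      to-·    : ∀ c x → to (c · x) ≈ c · to x
      to-from : ∀ x → to (from x) ≈ x
      kernel  : ∀ {x} → to x ≈ 0# → x ≈ 0#

  module _ (F : Automorphism) where
    open Automorphism F

    -- With preimages instead of images, membership is a plain statement about `to x` and carries no
    -- witness.
    preimage : Subspace → Subspace
    preimage V = (λ x → to x ∈ ⟦ V ⟧) , record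
      { resp-≈   = λ x≈y → V.resp-≈ (to-cong x≈y)
      ; 0∈       = V.resp-≈ (L.sym to-0) V.0∈
      ; +-closed = λ x∈ y∈ → V.resp-≈ (L.sym (to-+ _ _)) (V.+-closed x∈ y∈)
      ; ·-closed = λ c x∈ → V.resp-≈ (L.sym (to-· c _)) (V.·-closed c x∈)
      }
      where
      module V = Subspace V

    ⋖-preimage : ∀ {V W} → V ⋖ W → preimage V ⋖ preimage W
    ⋖-preimage {V} {W} V⋖W = record
      { inclusion = λ x∈ → inclusion x∈
      ; new   = from new
      ; new∈  = Subspace.resp-≈ W (L.sym (to-from new)) new∈
      ; new∉  = λ x∈ → new∉ (Subspace.resp-≈ V (to-from new) x∈)
      ; cover = λ {y} y∈ → let c , y+cx∈V = cover y∈ in c , Subspace.resp-≈ V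
          (L.sym (L.trans (to-+ y (c · from new))
            (L.+-congˡ (L.trans (to-· c (from new)) (·-congʳ c (to-from new)))))) y+cx∈V
      }
      where open _⋖_ V⋖W

    dim-preimage : ∀ {V n} → Dim V n → Dim (preimage V) n
    dim-preimage {V} (done (0⊆V , V⊆0)) = done
      (0ˢ⊆ (preimage V) , λ x∈ → lift (kernel (lower (V⊆0 x∈))))
    dim-preimage (ch ▸ cov) = dim-preimage ch ▸ ⋖-preimage cov

  *-≉0 : ∀ {x y z} → x * y ≈ z → ¬ z ≈ 0# → ¬ y ≈ 0#
  *-≉0 {x} xy≈z z≉0 y≈0 = z≉0 (L.trans (L.sym xy≈z) (L.trans (L.*-congˡ y≈0) (L.zeroʳ x)))

  *-≉0′ : ∀ {x y z} → x * y ≈ z → ¬ z ≈ 0# → ¬ x ≈ 0#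
  *-≉0′ {y = y} xy≈z z≉0 x≈0 = z≉0 (L.trans (L.sym xy≈z) (L.trans (L.*-congʳ x≈0) (L.zeroˡ y)))

  record Unit : Set (l ⊔ ℓ) where
    field
      val inv : Carrier
      inv*val : inv * val ≈ 1#
      val*inv : val * inv ≈ 1#

    val*[inv*x] : ∀ x → val * (inv * x) ≈ x
    val*[inv*x] x =
      L.trans (L.sym (L.*-assoc val inv x)) (L.trans (L.*-congʳ val*inv) (L.*-identityˡ x))

    [x*inv]*val : ∀ x → x * inv * val ≈ x
    [x*inv]*val x =
      L.trans (L.*-assoc x inv val) (L.trans (L.*-congˡ inv*val) (L.*-identityʳ x))

  inverse : Unit → Unit
  inverse u = record { val = inv ; inv = val ; inv*val = val*inv ; val*inv = inv*val }
    where open Unit u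

  unit : ∀ x → ¬ x ≈ 0# → Unit
  unit x x≉0 = record
    { val = x ; inv = proj₁ x⁻¹ ; inv*val = proj₁ (proj₂ x⁻¹) ; val*inv = proj₂ (proj₂ x⁻¹) }
    where x⁻¹ = IsDivisionRing.invertible isDivisionRing x x≉0

  module _ (u : Unit) where
    open Unit u
    open Unit (inverse u) using () renaming (val*[inv*x] to inv*[val*x]; [x*inv]*val to [x*val]*inv)

    *ˡ-automorphism : Automorphism
    *ˡ-automorphism = record
      { to = val *_ ; from = inv *_
      ; to-cong = L.*-congˡ ; to-0 = L.zeroʳ val ; to-+ = L.distribˡ val
      ; to-· = *-·-comm val ; to-from = val*[inv*x]
      ; kernel = λ {x} eq →
          L.trans (L.sym (inv*[val*x] x)) (L.trans (L.*-congˡ eq) (L.zeroʳ inv))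
      }

    *ʳ-automorphism : Automorphism
    *ʳ-automorphism = record
      { to = _* val ; from = _* inv
      ; to-cong = L.*-congʳ ; to-0 = L.zeroˡ val ; to-+ = λ x y → L.distribʳ val x y
      ; to-· = λ c x → L.*-assoc (ι c) x val ; to-from = [x*inv]*val
      ; kernel = λ {x} eq →
          L.trans (L.sym ([x*val]*inv x)) (L.trans (L.*-congʳ eq) (L.zeroˡ inv))
      }

  infixr 8 _⋊_
  infixl 8 _⋉_

  -- u ⋊ V is uV and V ⋉ u is Vu, as preimages under multiplication by u⁻¹.
  _⋊_ : Unit → Subspace → Subspace
  u ⋊ V = preimage (*ˡ-automorphism (inverse u)) V

  _⋉_ : Subspace → Unit → Subspace
  V ⋉ u = preimage (*ʳ-automorphism (inverse u)) V

  -- The span of a product set.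

  Products⊆ : Subspace → Subspace → Subspace → Set _
  Products⊆ A B W = ∀ {x y} → x ∈ ⟦ A ⟧ → y ∈ ⟦ B ⟧ → x * y ∈ ⟦ W ⟧

  ⟨⟩-cons : ∀ {p} (X : Pred Carrier p) {x y} → x ∈ X → y ∈ ⟨ X ⟩ → x ⊹ y ∈ ⟨ X ⟩
  ⟨⟩-cons X {x} x∈X (n , c , v , v∈X , eq) =
    suc n , K.1# Vector.∷ c , x Vector.∷ v , (λ { zero → x∈X ; (suc i) → v∈X i }) ,
    L.+-cong (L.sym (1·x≈x x)) eq

  ⟨⟩-mono : ∀ {p q} (X : Pred Carrier p) (Y : Pred Carrier q) → X ⊆ Y → ⟨ X ⟩ ⊆ ⟨ Y ⟩
  ⟨⟩-mono X Y X⊆Y (n , c , v , v∈X , eq) = n , c , v , (λ i → X⊆Y (v∈X i)) , eq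

  ⟨⟩-resp-≈ : ∀ {p} (X : Pred Carrier p) {x y} → x ≈ y → y ∈ ⟨ X ⟩ → x ∈ ⟨ X ⟩
  ⟨⟩-resp-≈ X x≈y (n , c , v , v∈X , eq) = n , c , v , v∈X , L.trans x≈y eq

  -- Induction along the chain of `A`: a new vector `u` contributes the translate `uB`. The
  -- resulting `W` is the span of the products, and its finite dimension bounds the search for a
  -- maximal pair.
  product-space : ∀ {A B m n} → Dim A m → Dim B n →
    ∃₂ λ W N → Dim W N × Products⊆ A B W × ⟦ W ⟧ ⊆ ⟨ ⟦ A ⟧ ∙ ⟦ B ⟧ ⟩
  product-space (done (_ , A⊆0)) B-dim =
    0ˢ , 0 , done (id , id) ,
    (λ {x} {y} x∈A _ → lift (L.trans (L.*-congʳ (lower (A⊆0 x∈A))) (L.zeroˡ y))) ,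
    λ (lift x≈0) → 0 , (λ ()) , (λ ()) , (λ ()) , x≈0
  product-space {B = B} (_▸_ {W = A} {W′ = A′} A-dim A⋖A′) B-dim
    with W , N , W-dim , AB⊆W , W⊆⟨AB⟩ ← product-space A-dim B-dim
    with _ , N′ , _ , W′-dim , _ ← dim-∩-+
           (dim-preimage (*ˡ-automorphism (inverse (unit (_⋖_.new A⋖A′)
             (λ x≈0 → _⋖_.new∉ A⋖A′ (0ˢ⊆ A (lift x≈0)))))) B-dim) W-dim =
      u ⋊ B +ˢ W , N′ , W′-dim , A′B⊆W′ , W′⊆⟨A′B⟩
    where
    open _⋖_ A⋖A′
    u : Unit
    u = unit new (λ x≈0 → new∉ (0ˢ⊆ A (lift x≈0)))
    open Unit u using (inv; val*[inv*x])
    open Unit (inverse u) using () renaming (val*[inv*x] to inv*[val*x])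
    module W′ = Subspace (u ⋊ B +ˢ W)

    A′B⊆W′ : Products⊆ A′ B (u ⋊ B +ˢ W)
    -- `x ⊹ c · new` lies in `A`, so its product with `y` is in `W`; the difference `c · new * y` is
    -- in `uB`.
    A′B⊆W′ {x} {y} x∈A′ y∈B with c , x+cu∈A ← cover x∈A′ = W′.cancelʳ
      (W′.·-closed c (+ˢ-inˡ (u ⋊ B) W (Subspace.resp-≈ B (L.sym (inv*[val*x] y)) y∈B)))
      (W′.resp-≈ (L.trans (L.distribʳ y x (c · new)) (L.+-congˡ (L.*-assoc (ι c) new y)))
        (+ˢ-inʳ (u ⋊ B) W (AB⊆W x+cu∈A y∈B)))

    W′⊆⟨A′B⟩ : ⟦ u ⋊ B +ˢ W ⟧ ⊆ ⟨ ⟦ A′ ⟧ ∙ ⟦ B ⟧ ⟩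
    W′⊆⟨A′B⟩ (z , w , z∈uB , w∈W , eq) = ⟨⟩-resp-≈ (⟦ A′ ⟧ ∙ ⟦ B ⟧) eq (⟨⟩-cons (⟦ A′ ⟧ ∙ ⟦ B ⟧)
      (new , inv * z , new∈ , z∈uB , L.sym (val*[inv*x] z))
      (⟨⟩-mono (⟦ A ⟧ ∙ ⟦ B ⟧) (⟦ A′ ⟧ ∙ ⟦ B ⟧)
        (λ (x , y , x∈A , y∈B , eq′) → x , y , inclusion x∈A , y∈B , eq′) (W⊆⟨AB⟩ w∈W)))

  -- The subfield K and conjugate subfields.

  scalars : Subspace
  scalars = line 1#

  ∈scalars⇒*≈· : ∀ {x} → x ∈ ⟦ scalars ⟧ → ∃[ c ] ∀ y → x * y ≈ c · y
  ∈scalars⇒*≈· (lift (c , x≈c1)) = c , λ y →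
    L.*-congʳ (L.trans x≈c1 (L.*-identityʳ (ι c)))

  scalars-isSubfield : IsSubfield ⟦ scalars ⟧
  scalars-isSubfield = record
    { resp-≈ = resp-≈ ; 0∈ = 0∈ ; 1∈ = line-self 1# ; +-closed = +-closed
    ; -‿closed = neg-closed
    ; *-closed = λ {x} {y} x∈ y∈ → let c , x*≈c· = ∈scalars⇒*≈· x∈ in
        resp-≈ (L.sym (x*≈c· y)) (·-closed c y∈)
    ; inv-closed = λ {x} {y} x∈ xy≈1 → let c , x*≈c· = ∈scalars⇒*≈· x∈
                                           cy≈1 = L.trans (L.sym (x*≈c· y)) xy≈1 in
        ·-cancel (*-≉0′ cy≈1 (IsDivisionRing.1≉0 isDivisionRing))
          (resp-≈ (L.sym cy≈1) (line-self 1#))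
    }
    where open Subspace scalars

  scalars-dim : Dim scalars 1
  scalars-dim = done (id , id) ▸ ⋖-respʳ
    (+ˢ-least 0ˢ scalars scalars (0ˢ⊆ scalars) id , +ˢ-inʳ 0ˢ scalars)
    (⋖-adjoin 0ˢ (λ (lift 1≈0) → IsDivisionRing.1≉0 isDivisionRing 1≈0))

  scalars∙S≐S : ∀ S → ⟦ scalars ⟧ ∙ ⟦ S ⟧ ≐ ⟦ S ⟧
  scalars∙S≐S S =
      (λ (x , y , x∈ , y∈S , z≈xy) → let c , x*≈c· = ∈scalars⇒*≈· x∈ in
        resp-≈ (L.sym (L.trans z≈xy (x*≈c· y))) (·-closed c y∈S))
    , λ {y} y∈S → 1# , y , line-self 1# , y∈S , L.sym (L.*-identityˡ y)
    where open Subspace S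

  module _ (u : Unit) where
    open Unit u
    open Unit (inverse u) using () renaming ([x*inv]*val to [x*val]*inv)

    -- u H u⁻¹
    conjugate : Subspace → Subspace
    conjugate H = preimage (*ʳ-automorphism u) (u ⋊ H)

    conj-* : ∀ x y → inv * (x * y * val) ≈ inv * (x * val) * (inv * (y * val))
    conj-* x y = begin
      inv * (x * y * val)                     ≈⟨ L.*-congˡ (L.*-assoc x y val) ⟩
      inv * (x * (y * val))                   ≈⟨ L.*-congˡ (L.*-congˡ (val*[inv*x] (y * val))) ⟨
      inv * (x * (val * (inv * (y * val))))   ≈⟨ L.*-congˡ (L.*-assoc x val _) ⟨
      inv * (x * val * (inv * (y * val)))     ≈⟨ L.*-assoc inv (x * val) _ ⟨
      inv * (x * val) * (inv * (y * val))     ∎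

    conj-1 : inv * (1# * val) ≈ 1#
    conj-1 = L.trans (L.*-congˡ (L.*-identityˡ val)) inv*val

    conjugate-isSubfield : ∀ {H} → IsSubfield ⟦ H ⟧ → IsSubfield ⟦ conjugate H ⟧
    conjugate-isSubfield {H} H-isSubfield = record
      { resp-≈ = uH.resp-≈ ; 0∈ = uH.0∈ ; 1∈ = resp-≈ (L.sym conj-1) 1∈
      ; +-closed = uH.+-closed
      ; -‿closed = uH.neg-closed
      ; *-closed = λ {x} {y} x∈ y∈ → resp-≈ (L.sym (conj-* x y)) (*-closed x∈ y∈)
      ; inv-closed = λ {x} {y} x∈ xy≈1 → inv-closed x∈ (L.trans (L.sym (conj-* x y))
          (L.trans (L.*-congˡ (L.*-congʳ xy≈1)) conj-1))
      }
      where
      open IsSubfield H-isSubfield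
      module uH = Subspace (conjugate H)

    conjugate-dim : ∀ {H h} → Dim H h → Dim (conjugate H) h
    conjugate-dim H-dim =
      dim-preimage (*ʳ-automorphism u) (dim-preimage (*ˡ-automorphism (inverse u)) H-dim)

  -- Saturated pairs.

  -- The conclusion of the theorem, with `W` for the span of the products and `d` for the sum of the
  -- dimensions. That `H` contains K follows from `H` being a subspace with 1.
  record Outcome (W : Subspace) (d : ℕ) : Set (Level.suc (k ⊔ l ⊔ ℓ)) where
    field
      {S H}        : Subspace
      {dimS dimH}  : ℕ
      S-dim        : Dim S dimS
      H-dim        : Dim H dimH
      S⊆W          : ⟦ S ⟧ ⊆ ⟦ W ⟧
      H-isSubfield : IsSubfield ⟦ H ⟧
      bound        : d ≤ dimS + dimH
      stable       : ⟦ H ⟧ ∙ ⟦ S ⟧ ≐ ⟦ S ⟧ ⊎ ⟦ S ⟧ ∙ ⟦ H ⟧ ≐ ⟦ S ⟧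

  Stabilises : Subspace → Subspace → Carrier → Set _
  Stabilises A B g =
    (∀ {x} → x ∈ ⟦ A ⟧ → x * g ∈ ⟦ A ⟧) × (∀ {y} → y ∈ ⟦ B ⟧ → g * y ∈ ⟦ B ⟧)

  -- For nonzero `g` this says that A ∩ Ag and B ∩ g⁻¹B are nonzero, which keeps both exchanged
  -- pairs nonzero.
  Meets : Subspace → Subspace → Carrier → Set _
  Meets A B g =
    (∃[ a ] a ∈ ⟦ A ⟧ × ¬ a ≈ 0# × a * g ∈ ⟦ A ⟧) × (∃[ b ] b ∈ ⟦ B ⟧ × ¬ b ≈ 0# × g * b ∈ ⟦ B ⟧)

  module Saturated
    {A B W m n} (A-dim : Dim A m) (B-dim : Dim B n)
    {a₀ b₀} (a₀∈A : a₀ ∈ ⟦ A ⟧) (a₀≉0 : ¬ a₀ ≈ 0#) (b₀∈B : b₀ ∈ ⟦ B ⟧) (b₀≉0 : ¬ b₀ ≈ 0#)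
    (AB⊆W : Products⊆ A B W)
    (meets⇒stabilises : ∀ {g} → Meets A B g → Stabilises A B g)
    where

    module A = Subspace A
    module B = Subspace B
    module W = Subspace W

    a b : Unit
    a = unit a₀ a₀≉0
    b = unit b₀ b₀≉0
    open Unit a using () renaming (inv to a⁻¹; val*[inv*x] to a[a⁻¹x])
    open Unit b using () renaming (inv to b⁻¹; [x*inv]*val to [xb⁻¹]b)

    -- H = a⁻¹A ∩ Bb⁻¹
    H : Subspace
    H = preimage (*ˡ-automorphism a) A ∩ preimage (*ʳ-automorphism b) B

    -- `a₀` and `b₀` are themselves the witnesses for `Meets`. Together with `stabiliser∈H`, this
    -- makes `H` the set of all stabilising `g`, whatever `a₀` and `b₀` are.
    H-stabilises : ∀ {g} → g ∈ ⟦ H ⟧ → Stabilises A B g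
    H-stabilises (ag∈A , gb∈B) =
      meets⇒stabilises ((a₀ , a₀∈A , a₀≉0 , ag∈A) , (b₀ , b₀∈B , b₀≉0 , gb∈B))

    stabiliser∈H : ∀ {g} → Stabilises A B g → g ∈ ⟦ H ⟧
    stabiliser∈H (Ag⊆A , gB⊆B) = Ag⊆A a₀∈A , gB⊆B b₀∈B

    H-isSubfield : IsSubfield ⟦ H ⟧
    H-isSubfield = record
      { resp-≈ = Subspace.resp-≈ H ; 0∈ = Subspace.0∈ H
      ; 1∈ = A.resp-≈ (L.sym (L.*-identityʳ a₀)) a₀∈A , B.resp-≈ (L.sym (L.*-identityˡ b₀)) b₀∈B
      ; +-closed = Subspace.+-closed H ; -‿closed = Subspace.neg-closed H
      ; *-closed = λ {x} {y} x∈H@(ax∈A , _) y∈H@(_ , yb∈B) →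
            A.resp-≈ (L.*-assoc a₀ x y) (proj₁ (H-stabilises y∈H) ax∈A)
          , B.resp-≈ (L.sym (L.*-assoc x y b₀)) (proj₂ (H-stabilises x∈H) yb∈B)
      ; inv-closed = inv-closed
      }
      where
      inv-closed : ∀ {x y} → x ∈ ⟦ H ⟧ → x * y ≈ 1# → y ∈ ⟦ H ⟧
      inv-closed {x} {y} x∈H xy≈1 =
          -- Ax ⊆ A means A ⊆ Ax⁻¹, an equality since the dimensions agree; and `a₀ * y` is in Ax⁻¹
          -- because `a₀ * y * x` is `a₀`. The other side is symmetric.
          dim-≥⇒⊇ {A} {Ax⁻¹} A-dim (dim-preimage (*ʳ-automorphism u) A-dim)
            (proj₁ (H-stabilises x∈H)) ℕ.≤-refl
            (A.resp-≈ (L.sym (L.trans (L.*-assoc a₀ y x)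
              (L.trans (L.*-congˡ yx≈1) (L.*-identityʳ a₀)))) a₀∈A)
        , dim-≥⇒⊇ {B} {x⁻¹B} B-dim (dim-preimage (*ˡ-automorphism u) B-dim)
            (proj₂ (H-stabilises x∈H)) ℕ.≤-refl
            (B.resp-≈ (L.sym (L.trans (L.sym (L.*-assoc x y b₀))
              (L.trans (L.*-congʳ xy≈1) (L.*-identityˡ b₀)))) b₀∈B)
        where
        u : Unit
        u = unit x (*-≉0′ xy≈1 (IsDivisionRing.1≉0 isDivisionRing))
        open Unit u using (inv; inv*val)
        open Unit (inverse u) using () renaming (val*[inv*x] to inv*[val*x])
        Ax⁻¹ x⁻¹B : Subspace
        Ax⁻¹ = preimage (*ʳ-automorphism u) A
        x⁻¹B = preimage (*ˡ-automorphism u) B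
        y≈inv : y ≈ inv
        y≈inv = L.trans (L.sym (inv*[val*x] y)) (L.trans (L.*-congˡ xy≈1) (L.*-identityʳ inv))
        yx≈1 : y * x ≈ 1#
        yx≈1 = L.trans (L.*-congʳ y≈inv) inv*val

    H-dim : ∃ (Dim H)
    H-dim = dim-sub proj₁ (dim-preimage (*ˡ-automorphism a) A-dim)

    aB⊆W : ∀ u → Unit.val u ∈ ⟦ A ⟧ → ⟦ u ⋊ B ⟧ ⊆ ⟦ W ⟧
    aB⊆W u u∈A {x} x∈uB = W.resp-≈ (Unit.val*[inv*x] u x) (AB⊆W u∈A x∈uB)

    Ab⊆W : ∀ u → Unit.val u ∈ ⟦ B ⟧ → ⟦ A ⋉ u ⟧ ⊆ ⟦ W ⟧
    Ab⊆W u u∈B {x} x∈Au = W.resp-≈ (Unit.[x*inv]*val u x) (AB⊆W x∈Au u∈B)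

    -- A direct sum has dimension `d + d`, which already reaches `m + n`, so K can serve as the
    -- subfield: it stabilises every subspace.
    direct-sum-outcome : ∀ {V V′ d} → Dim V d → Dim V′ d → m + n ≤ d + d →
      ⟦ V ⟧ ⊆ ⟦ W ⟧ → ⟦ V′ ⟧ ⊆ ⟦ W ⟧ → ⟦ V ∩ V′ ⟧ ⊆ ⟦ 0ˢ ⟧ → Outcome W (m + n)
    direct-sum-outcome {V} {V′} {d} V-dim V′-dim m+n≤d+d V⊆W V′⊆W V∩V′⊆0
      with p , q , ∩-dim , +-dim , p+q≡d+d ← dim-∩-+ V-dim V′-dim
      -- The intersection has dimension at most 0, so this match sets `p` to zero and leaves
      -- `q ≡ d + d`.
      with z≤n ← dim-mono {V ∩ V′} {0ˢ} ∩-dim (done (id , id)) V∩V′⊆0 = record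
      { S-dim = +-dim ; H-dim = scalars-dim
      ; S⊆W = +ˢ-least V V′ W V⊆W V′⊆W
      ; H-isSubfield = scalars-isSubfield
      ; bound = ℕ.≤-trans m+n≤d+d (ℕ.≤-trans (ℕ.≤-reflexive (≡.sym p+q≡d+d)) (ℕ.m≤m+n q 1))
      ; stable = inj₁ (scalars∙S≐S (V +ˢ V′))
      }

    outcome-left : m ≤ n → Outcome W (m + n)
    outcome-left m≤n with em {Lift k (∃[ a₁ ] a₁ ∈ ⟦ A ⟧ × a⁻¹ * a₁ ∉ ⟦ H ⟧)}
    -- `A` lies in aH, so m ≤ dim H. As HB ⊆ B, the translate aB is stable under aHa⁻¹.
    ... | no A⊆aH = record
      { S-dim = dim-preimage (*ˡ-automorphism (inverse a)) B-dim
      ; H-dim = conjugate-dim a (proj₂ H-dim)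
      ; S⊆W = aB⊆W a a₀∈A
      ; H-isSubfield = conjugate-isSubfield a {H} H-isSubfield
      ; bound = ℕ.≤-trans (ℕ.+-monoˡ-≤ n m≤dimH) (ℕ.≤-reflexive (ℕ.+-comm _ n))
      ; stable = inj₁
          ( (λ (x , y , x∈ , y∈ , z≈xy) → B.resp-≈
              (L.trans (L.*-assoc a⁻¹ _ _) (L.*-congˡ (L.trans (L.*-assoc x a₀ _)
                (L.trans (L.*-congˡ (a[a⁻¹x] y)) (L.sym z≈xy)))))
              (proj₂ (H-stabilises x∈) y∈))
          , λ {y} y∈ → 1# , y , IsSubfield.1∈ (conjugate-isSubfield a {H} H-isSubfield) , y∈ ,
              L.sym (L.*-identityˡ y))
      }
      where
      m≤dimH : m ≤ proj₁ H-dim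
      m≤dimH = dim-mono A-dim (dim-preimage (*ˡ-automorphism (inverse a)) (proj₂ H-dim)) A⊆
        where
        A⊆ : ∀ {x} → x ∈ ⟦ A ⟧ → a⁻¹ * x ∈ ⟦ H ⟧
        A⊆ {x} x∈A with (a⁻¹ * x) ∈? H
        ... | yes a⁻¹x∈H = a⁻¹x∈H
        ... | no a⁻¹x∉H = contradiction (lift (x , x∈A , a⁻¹x∉H)) A⊆aH
    ... | yes (lift (a₁ , a₁∈A , g∉H)) = direct-sum-outcome
      (dim-preimage (*ˡ-automorphism (inverse a)) B-dim)
      (dim-preimage (*ˡ-automorphism (inverse u)) B-dim)
      (ℕ.+-monoˡ-≤ n m≤n) (aB⊆W a a₀∈A) (aB⊆W u a₁∈A) disjoint
      where
      u : Unit
      u = unit a₁ (λ a₁≈0 → g∉H (Subspace.resp-≈ H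
        (L.sym (L.trans (L.*-congˡ a₁≈0) (L.zeroʳ a⁻¹))) (Subspace.0∈ H)))
      open Unit u using () renaming (inv to a₁⁻¹; val*[inv*x] to a₁[a₁⁻¹x])

      disjoint : ⟦ a ⋊ B ∩ u ⋊ B ⟧ ⊆ ⟦ 0ˢ ⟧
      disjoint {y} (a⁻¹y∈B , a₁⁻¹y∈B) with y ≈0?
      ... | yes y≈0 = lift y≈0
      -- Right multiplication by a⁻¹a₁ sends `a₀` to `a₁` in `A`, and left multiplication sends
      -- a₁⁻¹y to a⁻¹y in `B`; so a⁻¹a₁ would lie in `H`.
      ... | no y≉0 = contradiction (stabiliser∈H (meets⇒stabilises
        ( (a₀ , a₀∈A , a₀≉0 , A.resp-≈ (L.sym (a[a⁻¹x] a₁)) a₁∈A)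
        , (a₁⁻¹ * y , a₁⁻¹y∈B , *-≉0 (a₁[a₁⁻¹x] y) y≉0 ,
           B.resp-≈ (L.sym (L.trans (L.*-assoc a⁻¹ a₁ _) (L.*-congˡ (a₁[a₁⁻¹x] y)))) a⁻¹y∈B))))
        g∉H

    outcome-right : n ≤ m → Outcome W (m + n)
    outcome-right n≤m with em {Lift k (∃[ b₁ ] b₁ ∈ ⟦ B ⟧ × b₁ * b⁻¹ ∉ ⟦ H ⟧)}
    ... | no B⊆Hb = record
      { S-dim = dim-preimage (*ʳ-automorphism (inverse b)) A-dim
      -- On this side the subfield is b⁻¹Hb, since (Ab)(b⁻¹Hb) = AHb ⊆ Ab.
      ; H-dim = conjugate-dim (inverse b) (proj₂ H-dim)
      ; S⊆W = Ab⊆W b b₀∈B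
      ; H-isSubfield = conjugate-isSubfield (inverse b) {H} H-isSubfield
      ; bound = ℕ.+-monoʳ-≤ m n≤dimH
      ; stable = inj₂
          ( (λ (x , y , x∈ , y∈ , z≈xy) → A.resp-≈
              (L.trans (L.sym (L.*-assoc _ b₀ _)) (L.trans (L.*-congʳ ([xb⁻¹]b x))
                (L.trans (L.sym (L.*-assoc x y b⁻¹)) (L.*-congʳ (L.sym z≈xy)))))
              (proj₁ (H-stabilises y∈) x∈))
          , λ {y} y∈ → y , 1# , y∈ ,
              IsSubfield.1∈ (conjugate-isSubfield (inverse b) {H} H-isSubfield) ,
              L.sym (L.*-identityʳ y))
      }
      where
      n≤dimH : n ≤ proj₁ H-dim
      n≤dimH = dim-mono B-dim (dim-preimage (*ʳ-automorphism (inverse b)) (proj₂ H-dim)) B⊆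
        where
        B⊆ : ∀ {x} → x ∈ ⟦ B ⟧ → x * b⁻¹ ∈ ⟦ H ⟧
        B⊆ {x} x∈B with (x * b⁻¹) ∈? H
        ... | yes xb⁻¹∈H = xb⁻¹∈H
        ... | no xb⁻¹∉H = contradiction (lift (x , x∈B , xb⁻¹∉H)) B⊆Hb
    ... | yes (lift (b₁ , b₁∈B , g∉H)) = direct-sum-outcome
      (dim-preimage (*ʳ-automorphism (inverse b)) A-dim)
      (dim-preimage (*ʳ-automorphism (inverse u)) A-dim)
      (ℕ.+-monoʳ-≤ m n≤m) (Ab⊆W b b₀∈B) (Ab⊆W u b₁∈B) disjoint
      where
      u : Unit
      u = unit b₁ (λ b₁≈0 → g∉H (Subspace.resp-≈ H
        (L.sym (L.trans (L.*-congʳ b₁≈0) (L.zeroˡ b⁻¹))) (Subspace.0∈ H)))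
      open Unit u using () renaming (inv to b₁⁻¹; [x*inv]*val to [xb₁⁻¹]b₁)

      disjoint : ⟦ A ⋉ b ∩ A ⋉ u ⟧ ⊆ ⟦ 0ˢ ⟧
      disjoint {y} (yb⁻¹∈A , yb₁⁻¹∈A) with y ≈0?
      ... | yes y≈0 = lift y≈0
      -- Here the element is b₁b⁻¹: it takes yb₁⁻¹ to yb⁻¹ in `A`, and `b₀` to `b₁` in `B`.
      ... | no y≉0 = contradiction (stabiliser∈H (meets⇒stabilises
        ( (y * b₁⁻¹ , yb₁⁻¹∈A , *-≉0′ ([xb₁⁻¹]b₁ y) y≉0 ,
           A.resp-≈ (L.sym (L.trans (L.sym (L.*-assoc _ b₁ b⁻¹)) (L.*-congʳ ([xb₁⁻¹]b₁ y)))) yb⁻¹∈A)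
        , (b₀ , b₀∈B , b₀≉0 , B.resp-≈ (L.sym ([xb⁻¹]b b₁)) b₁∈B))))
        g∉H

    outcome : Outcome W (m + n)
    outcome with ℕ.≤-total m n
    ... | inj₁ m≤n = outcome-left m≤n
    ... | inj₂ n≤m = outcome-right n≤m

  outcome-weaken : ∀ {W d e} → d ≤ e → Outcome W e → Outcome W d
  outcome-weaken d≤e o = record
    { S-dim = S-dim ; H-dim = H-dim ; S⊆W = S⊆W ; H-isSubfield = H-isSubfield
    ; bound = ℕ.≤-trans d≤e bound ; stable = stable }
    where open Outcome o

  -- The exchange step, a linear analogue of Dyson's e-transform.

  module Exchange
    {A B W} (AB⊆W : Products⊆ A B W)
    {g a b} (a∈A : a ∈ ⟦ A ⟧) (a≉0 : ¬ a ≈ 0#) (ag∈A : a * g ∈ ⟦ A ⟧)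
    (b∈B : b ∈ ⟦ B ⟧) (b≉0 : ¬ b ≈ 0#) (gb∈B : g * b ∈ ⟦ B ⟧) (g≉0 : ¬ g ≈ 0#)
    where

    u : Unit
    u = unit g g≉0
    open Unit u using () renaming ([x*inv]*val to [xg⁻¹]g)
    open Unit (inverse u) using () renaming ([x*inv]*val to [xg]g⁻¹)

    Ag g⁻¹B : Subspace
    Ag   = A ⋉ u
    g⁻¹B = inverse u ⋊ B

    -- The inserted factors cancel in the middle: xy = (xg⁻¹)(gy).
    shifted : ∀ {x y} → x ∈ ⟦ Ag ⟧ → y ∈ ⟦ g⁻¹B ⟧ → x * y ∈ ⟦ W ⟧
    shifted {x} {y} xg⁻¹∈A gy∈B = Subspace.resp-≈ W
      (L.trans (L.sym (L.*-assoc _ g y)) (L.*-congʳ ([xg⁻¹]g x))) (AB⊆W xg⁻¹∈A gy∈B)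

    up-down : Products⊆ (A +ˢ Ag) (B ∩ g⁻¹B) W
    up-down {y = y} (v , v′ , v∈ , v′∈ , eq) (y∈B , y∈g⁻¹B) = Subspace.resp-≈ W
      (L.sym (L.trans (L.*-congʳ eq) (L.distribʳ y v v′)))
      (Subspace.+-closed W (AB⊆W v∈ y∈B) (shifted v′∈ y∈g⁻¹B))

    down-up : Products⊆ (A ∩ Ag) (B +ˢ g⁻¹B) W
    down-up {x} (x∈A , x∈Ag) (v , v′ , v∈ , v′∈ , eq) = Subspace.resp-≈ W
      (L.sym (L.trans (L.*-congˡ eq) (L.distribˡ x v v′)))
      (Subspace.+-closed W (AB⊆W x∈A v∈) (shifted x∈Ag v′∈))

    A∩Ag-nonzero : Nonzero ⟦ A ∩ Ag ⟧
    A∩Ag-nonzero =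
      a * g , (ag∈A , Subspace.resp-≈ A (L.sym ([xg]g⁻¹ a)) a∈A) , *-≉0′ ([xg]g⁻¹ a) a≉0

    B∩g⁻¹B-nonzero : Nonzero ⟦ B ∩ g⁻¹B ⟧
    B∩g⁻¹B-nonzero = b , (b∈B , gb∈B) , b≉0

    A+Ag-nonzero : Nonzero ⟦ A +ˢ Ag ⟧
    A+Ag-nonzero = a , +ˢ-inˡ A Ag a∈A , a≉0

    B+g⁻¹B-nonzero : Nonzero ⟦ B +ˢ g⁻¹B ⟧
    B+g⁻¹B-nonzero = b , +ˢ-inˡ B g⁻¹B b∈B , b≉0

    -- If A + Ag is no larger than A, then Ag ⊆ A; if B ∩ g⁻¹B is no smaller than B, then gB ⊆ B.
    fixed⇒stabilises : ∀ {m m′ n n′} → Dim A m → Dim (A +ˢ Ag) m′ → m′ ≤ m →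
      Dim B n → Dim (B ∩ g⁻¹B) n′ → n ≤ n′ → Stabilises A B g
    fixed⇒stabilises A-dim A+-dim m′≤m B-dim B∩-dim n≤n′ =
        (λ {x} x∈A → dim-≥⇒⊇ {A} {A +ˢ Ag} A-dim A+-dim (+ˢ-inˡ A Ag) m′≤m
          (+ˢ-inʳ A Ag (Subspace.resp-≈ A (L.sym ([xg]g⁻¹ x)) x∈A)))
      , (λ y∈B → proj₂ (dim-≥⇒⊇ {B ∩ g⁻¹B} {B} B∩-dim B-dim proj₁ n≤n′ y∈B))

  -- `Meets` admits `g = 0`, which has no inverse to exchange with; this shows that an element
  -- failing to stabilise is nonzero.
  0-stabilises : ∀ A B {g} → g ≈ 0# → Stabilises A B g
  0-stabilises A B g≈0 =
      (λ {x} _ → 0ˢ⊆ A (lift (L.trans (L.*-congˡ g≈0) (L.zeroʳ x))))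
    , (λ {y} _ → 0ˢ⊆ B (lift (L.trans (L.*-congʳ g≈0) (L.zeroˡ y))))

  -- Improving pairs until saturation.

  record Pair (W : Subspace) : Set (Level.suc (k ⊔ l ⊔ ℓ)) where
    constructor pair
    field
      {A B}   : Subspace
      {m n}   : ℕ
      A-dim   : Dim A m
      B-dim   : Dim B n
      A≠0     : Nonzero ⟦ A ⟧
      B≠0     : Nonzero ⟦ B ⟧
      AB⊆W    : Products⊆ A B W

    total : ℕ
    total = m + n

    -- Multiplication by a fixed nonzero element of one factor embeds the other factor in `W`.
    total-≤ : ∀ {N} → Dim W N → total ≤ N + N
    total-≤ W-dim with a , a∈A , a≉0 ← A≠0 with b , b∈B , b≉0 ← B≠0 = ℕ.+-mono-≤
      (dim-mono A-dim (dim-preimage (*ʳ-automorphism (unit b b≉0)) W-dim) (λ x∈A → AB⊆W x∈A b∈B))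
      (dim-mono B-dim (dim-preimage (*ˡ-automorphism (unit a a≉0)) W-dim) (λ y∈B → AB⊆W a∈A y∈B))

  open Pair using (total)

  infix 4 _≺_
  -- The second alternative asks only that the total does not drop, which is what `complement-≥`
  -- yields.
  _≺_ : ∀ {W} → Pair W → Pair W → Set
  P ≺ P′ = total P < total P′ ⊎ (total P ≤ total P′ × Pair.n P′ < Pair.n P)

  saturated-or-improvable : ∀ {W} (P : Pair W) → Outcome W (total P) ⊎ ∃ (P ≺_)
  saturated-or-improvable {W} (pair {A} {B} {m} {n}
    A-dim B-dim (a , a∈A , a≉0) (b , b∈B , b≉0) AB⊆W)
    with em {Lift k (∃[ g ] Lift (k ⊔ l ⊔ ℓ) (Meets A B g) × ¬ Stabilises A B g)}
  ... | no ¬escape = inj₁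
    (Saturated.outcome {A} {B} {W} A-dim B-dim a∈A a≉0 b∈B b≉0 AB⊆W meets⇒stabilises)
    where
    meets⇒stabilises : ∀ {g} → Meets A B g → Stabilises A B g
    meets⇒stabilises {g} meets with em {Lift k (Stabilises A B g)}
    ... | yes (lift stab) = stab
    ... | no ¬stab = contradiction (lift (g , lift meets , λ stab → ¬stab (lift stab))) ¬escape
  ... | yes (lift (g , lift ((a′ , a′∈A , a′≉0 , a′g∈A) , (b′ , b′∈B , b′≉0 , gb′∈B)) , ¬stab)) =
    inj₂ (improve (dim-∩-+ A-dim Ag-dim) (dim-∩-+ B-dim g⁻¹B-dim))
    where
    open Exchange {A} {B} {W} AB⊆W a′∈A a′≉0 a′g∈A b′∈B b′≉0 gb′∈B
      (λ g≈0 → ¬stab (0-stabilises A B g≈0))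
    Ag-dim : Dim Ag m
    Ag-dim = dim-preimage (*ʳ-automorphism (inverse u)) A-dim
    g⁻¹B-dim : Dim g⁻¹B n
    g⁻¹B-dim = dim-preimage (*ˡ-automorphism u) B-dim

    improve :
      (∃₂ λ m₂ m₁ → Dim (A ∩ Ag) m₂ × Dim (A +ˢ Ag) m₁ × m₂ + m₁ ≡ m + m) →
      (∃₂ λ n₁ n₂ → Dim (B ∩ g⁻¹B) n₁ × Dim (B +ˢ g⁻¹B) n₂ × n₁ + n₂ ≡ n + n) →
      ∃ (pair A-dim B-dim (a , a∈A , a≉0) (b , b∈B , b≉0) AB⊆W ≺_)
    improve (m₂ , m₁ , A∩-dim , A+-dim , eqm) (n₁ , n₂ , B∩-dim , B+-dim , eqn)
      with ℕ.<-≤-connex (m + n) (m₁ + n₁) | ℕ.<-≤-connex (m + n) (m₂ + n₂) | ℕ.<-≤-connex n₁ n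
    ... | inj₁ lt | _ | _ =
      pair A+-dim B∩-dim A+Ag-nonzero B∩g⁻¹B-nonzero up-down , inj₁ lt
    ... | inj₂ _ | inj₁ lt | _ =
      pair A∩-dim B+-dim A∩Ag-nonzero B+g⁻¹B-nonzero down-up , inj₁ lt
    -- The second exchanged pair has no larger total, so the first has no smaller one, and its right
    -- factor has shrunk.
    ... | inj₂ _ | inj₂ ge | inj₁ n₁<n =
      pair A+-dim B∩-dim A+Ag-nonzero B∩g⁻¹B-nonzero up-down ,
      inj₂ (complement-≥ {m} {n} {m₁} {m₂} {n₁} {n₂} eqm eqn ge , n₁<n)
    -- With n ≤ n₁ and m₁ + n₁ ≤ m + n also m₁ ≤ m: the exchange changes neither space, so `g`
    -- stabilises both.
    ... | inj₂ le | inj₂ _ | inj₂ n≤n₁ = contradiction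
      (fixed⇒stabilises A-dim A+-dim
        (ℕ.+-cancelʳ-≤ n m₁ m (ℕ.≤-trans (ℕ.+-monoʳ-≤ m₁ n≤n₁) le)) B-dim B∩-dim n≤n₁) ¬stab

  -- Lexicographic descent: p bounds how far the total can still grow, q bounds dim B.
  search : ∀ {W N} → Dim W N → ∀ p q (P : Pair W) →
    N + N < total P + p → Pair.n P < q → Outcome W (total P)
  -- With `p` at zero the total would exceed `N + N`, against `total-≤`.
  search {N = N} W-dim zero q P 2N< _ = contradiction
    (ℕ.≤-<-trans (Pair.total-≤ P W-dim) (≡.subst (N + N <_) (ℕ.+-identityʳ (total P)) 2N<))
    (ℕ.<-irrefl ≡.refl)
  search W-dim (suc p) (suc q) P 2N< (s≤s n≤q) =
    [ id
    , (λ (P′ , P≺P′) →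
      -- A larger total may come with any dim B, so the second bound restarts just above it.
      [ (λ lt → outcome-weaken (ℕ.<⇒≤ lt) (search W-dim p (suc (Pair.n P′)) P′
          (ℕ.<-≤-trans 2N< (ℕ.≤-trans (ℕ.≤-reflexive (ℕ.+-suc (total P) p)) (ℕ.+-monoˡ-≤ p lt)))
          ℕ.≤-refl))
      , (λ (le , n′<n) → outcome-weaken le (search W-dim (suc p) q P′
          (ℕ.<-≤-trans 2N< (ℕ.+-monoˡ-≤ (suc p) le)) (ℕ.<-≤-trans n′<n n≤q)))
      ]′ P≺P′)
    ]′ (saturated-or-improvable P)

  -- From given bases to the final statement.

  -- `A` may live at any level, whereas the span of its basis is a `Subspace`. The inclusion in `A`
  -- later carries `S` into the span of the original products.
  basis-span : ∀ {p} {A : Pred Carrier p} {n} → IsSubspace A → HasDim A n → Nonzero A →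
    Σ[ V ∈ Subspace ] (Dim V n × ⟦ V ⟧ ⊆ A × Nonzero ⟦ V ⟧)
  basis-span A-isSubspace A-dim (x , x∈A , x≉0) with c , x≈cb ← HasDim.spanning A-dim x∈A =
      span basis , independent⇒dim-span basis independent
    , (λ y∈ → let d , y≈db = span⇒combination basis y∈ in IsSubspace.resp-≈ A-isSubspace
        (L.sym y≈db) (Closure.combination-closed A-isSubspace d basis∈))
    , x , Subspace.resp-≈ (span basis) (L.sym x≈cb) (combination∈span c basis) , x≉0
    where open HasDim A-dim

mainTheorem6 : (∀ {a} → ExcludedMiddle a) →
    ∀ {k kℓ l ℓ a b} (E : CentralExtension k kℓ l ℓ) →
    let open CentralExtension E
        open Linear E
    in
    (A : Pred L.Carrier a) (B : Pred L.Carrier b) (dimA dimB : ℕ) →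
    IsSubspace A → IsSubspace B →
    Nonzero A → Nonzero B →
    HasDim A dimA → HasDim B dimB →
    Σ[ S ∈ Pred L.Carrier (k ⊔ l ⊔ ℓ) ]
    Σ[ H ∈ Pred L.Carrier (k ⊔ l ⊔ ℓ) ]
    ∃[ dimS ] ∃[ dimH ]
    ( IsSubspace S × S ⊆ ⟨ A ∙ B ⟩
    × IsSubfield H × ContainsK H
    × HasDim S dimS × HasDim H dimH
    × dimA + dimB ≤ dimS + dimH
    × (H ∙ S ≐ S ⊎ S ∙ H ≐ S) )
mainTheorem6 em E A B dimA dimB A-isSubspace B-isSubspace A≠0 B≠0 A-dim B-dim
  with A′ , A′-dim , A′⊆A , A′≠0 ← LinearAlgebra.basis-span E em A-isSubspace A-dim A≠0
     | B′ , B′-dim , B′⊆B , B′≠0 ← LinearAlgebra.basis-span E em B-isSubspace B-dim B≠0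
  with W , N , W-dim , A′B′⊆W , W⊆ ← LinearAlgebra.product-space E em A′-dim B′-dim =
    ⟦ S ⟧ , ⟦ H ⟧ , dimS , dimH , Subspace.isSubspace S
  , (λ x∈S → ⟨⟩-mono (⟦ A′ ⟧ ∙ ⟦ B′ ⟧) (A ∙ B)
      (λ (x , y , x∈ , y∈ , eq) → x , y , A′⊆A x∈ , B′⊆B y∈ , eq) (W⊆ (S⊆W x∈S)))
  , H-isSubfield
  , (λ c → Subspace.resp-≈ H (L.*-identityʳ (ι c))
      (Subspace.·-closed H c (IsSubfield.1∈ H-isSubfield)))
  , dim⇒HasDim S-dim , dim⇒HasDim H-dim , bound , stable
  where
  open CentralExtension E
  open Linear E
  open LinearAlgebra E em
  open Subspace using (⟦_⟧)
  -- Both bounds of `search` are strict, hence the two successors: the first exceeds twice the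
  -- dimension of `W`, the second exceeds dim B.
  open Outcome (search W-dim (suc (N + N)) (suc dimB) (pair A′-dim B′-dim A′≠0 B′≠0 A′B′⊆W)
    (ℕ.m≤n+m (suc (N + N)) (dimA + dimB)) ℕ.≤-refl)
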